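{- There is an algorithm which, given a permutation $\pi$ of $\{1,\dots,n\}$, outputs a maximum induced matching of the permutation graph $G(\pi)$ in $\mathcal{O}(n^2)$ time.
   Context: For a permutation $\pi=(\pi(1),\dots,\pi(n))$ of $\{1,\dots,n\}$, $\pi^{ -1}(i)$ denotes the position of $i$ in $\pi$. The permutation graph $G(\pi)=(V,E)$ has $V=\{1,\dots,n\}$ and $uv\in E$ iff $(u-v)(\pi^{ -1}(u)-\pi^{ -1}(v))<0$. An induced matching of a graph $G=(V,E)$ is a set $M\subseteq E$ such that for any two distinct edges $u_1v_1,u_2v_2\in M$, none of $u_1u_2,u_1v_2,v_1u_2,v_1v_2$ is in $E$. A maximum induced matching is one of maximum cardinality. Running times are in the standard RAM model. -}

module Defs where

open import Data.Bool.Base using (if_then_else_)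
open import Data.Fin.Base using (Fin; toℕ; fromℕ<)
open import Data.Fin.Permutation using (Permutation′; _⟨$⟩ʳ_; _⟨$⟩ˡ_)
open import Data.Integer.Base as ℤ using (0ℤ)
open import Data.List.Base using (List; length; lookup; head; drop)
open import Data.List.Membership.Propositional using (_∈_)
open import Data.List.Relation.Unary.All using (All)
open import Data.List.Relation.Unary.AllPairs using (AllPairs)
open import Data.Maybe.Base using (Maybe; just)
open import Data.Nat.Base using (ℕ; zero; suc; _+_; _∸_; _*_; _^_; _≤_; _<_; _≮_)
open import Data.Nat.Properties using (_≟_; _<?_)
open import Data.Product.Base using (_×_; _,_; proj₁; proj₂; ∃-syntax)
open import Data.Sum.Base using (_⊎_)
open import Level using (0ℓ)
open import Relation.Binary.Core using (Rel)
open import Relation.Binary.PropositionalEquality.Core using (_≡_)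
open import Relation.Nullary.Decidable.Core using (does; yes; no)
open import Relation.Nullary.Negation.Core using (¬_)

-- The vertex i ∈ {1,…,n} is the element of Fin n with toℕ equal to i − 1;
-- the shift by one cancels in both differences.
PermutationGraph : ∀ {n} → Permutation′ n → Rel (Fin n) 0ℓ
PermutationGraph π u v =
  (int u ℤ.- int v) ℤ.* (int (π ⟨$⟩ˡ u) ℤ.- int (π ⟨$⟩ˡ v)) ℤ.< 0ℤ
  where
  int : ∀ {n} → Fin n → ℤ.ℤ
  int i = ℤ.+ toℕ i

module _ {V : Set} where

  -- An unordered pair {u,v} is represented by (u , v) or by (v , u).
  SameEdge : Rel (V × V) 0ℓ
  SameEdge (u₁ , v₁) (u₂ , v₂) = (u₁ ≡ u₂ × v₁ ≡ v₂) ⊎ (u₁ ≡ v₂ × v₁ ≡ u₂)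

  module _ (E : Rel V 0ℓ) where

    -- A finite set of edges is a list without repetitions up to SameEdge,
    -- so that its cardinality is the length of the list.
    record IsInducedMatching (M : List (V × V)) : Set where
      field
        edges    : All (λ (u , v) → E u v) M
        distinct : AllPairs (λ e f → ¬ SameEdge e f) M
        induced  : ∀ {u₁ v₁ u₂ v₂} → (u₁ , v₁) ∈ M → (u₂ , v₂) ∈ M →
                   ¬ SameEdge (u₁ , v₁) (u₂ , v₂) →
                   ¬ E u₁ u₂ × ¬ E u₁ v₂ × ¬ E v₁ u₂ × ¬ E v₁ v₂

    record IsMaximumInducedMatching (M : List (V × V)) : Set where
      field
        isInducedMatching : IsInducedMatching M
        maximum : ∀ M′ → IsInducedMatching M′ → length M′ ≤ length M

-- A random access machine: a load/store machine with unit-cost instructions on words of O(log n)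
-- bits.  Registers are addressed by constants only, so a program uses
-- boundedly many of them; memory is addressed indirectly.

Register Label : Set
Register = ℕ
Label    = ℕ

data Instruction : Set where
  const : Register → ℕ → Instruction
  copy  : Register → Register → Instruction
  add   : Register → Register → Register → Instruction
  sub   : Register → Register → Register → Instruction
  load  : Register → Register → Instruction
  store : Register → Register → Instruction
  jump  : Label → Instruction
  jlt   : Register → Register → Label → Instruction
  halt  : Instruction

Program : Set
Program = List Instruction

fetch : Program → Label → Maybe Instruction
fetch P l = head (drop l P)

infixl 6 _[_≔_]

_[_≔_] : (ℕ → ℕ) → ℕ → ℕ → (ℕ → ℕ)
(f [ a ≔ x ]) b = if does (b ≟ a) then x else f b

record Configuration : Set where
  constructor ⟨_,_,_⟩
  field
    pc  : Label
    reg : Register → ℕ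
    mem : ℕ → ℕ

open Configuration public

-- Execution of a single instruction on a machine whose words are the
-- numbers below W.  An instruction whose result is not a word has no
-- successor configuration: the machine is stuck, which is not halting.
-- Every configuration has at most one successor.
data Executes (W : ℕ) : Instruction → Rel Configuration 0ℓ where
  const : ∀ {l ρ μ r k} → k < W →
          Executes W (const r k) ⟨ l , ρ , μ ⟩ ⟨ suc l , ρ [ r ≔ k ] , μ ⟩
  copy  : ∀ {l ρ μ r s} →
          Executes W (copy r s) ⟨ l , ρ , μ ⟩ ⟨ suc l , ρ [ r ≔ ρ s ] , μ ⟩
  add   : ∀ {l ρ μ r s t} → ρ s + ρ t < W →
          Executes W (add r s t) ⟨ l , ρ , μ ⟩ ⟨ suc l , ρ [ r ≔ ρ s + ρ t ] , μ ⟩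
  sub   : ∀ {l ρ μ r s t} →
          Executes W (sub r s t) ⟨ l , ρ , μ ⟩ ⟨ suc l , ρ [ r ≔ ρ s ∸ ρ t ] , μ ⟩
  load  : ∀ {l ρ μ r s} →
          Executes W (load r s) ⟨ l , ρ , μ ⟩ ⟨ suc l , ρ [ r ≔ μ (ρ s) ] , μ ⟩
  store : ∀ {l ρ μ r s} →
          Executes W (store r s) ⟨ l , ρ , μ ⟩ ⟨ suc l , ρ , μ [ ρ r ≔ ρ s ] ⟩
  jump  : ∀ {l ρ μ l′} →
          Executes W (jump l′) ⟨ l , ρ , μ ⟩ ⟨ l′ , ρ , μ ⟩
  jlt-< : ∀ {l ρ μ r s l′} → ρ r < ρ s →
          Executes W (jlt r s l′) ⟨ l , ρ , μ ⟩ ⟨ l′ , ρ , μ ⟩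
  jlt-≮ : ∀ {l ρ μ r s l′} → ρ r ≮ ρ s →
          Executes W (jlt r s l′) ⟨ l , ρ , μ ⟩ ⟨ suc l , ρ , μ ⟩

data Runs (P : Program) (W : ℕ) : ℕ → Rel Configuration 0ℓ where
  done : ∀ {c} → Runs P W 0 c c
  step : ∀ {t i c d e} → fetch P (pc c) ≡ just i → Executes W i c d →
         Runs P W t d e → Runs P W (suc t) c e

record HaltsWithin (P : Program) (W T : ℕ) (c d : Configuration) : Set where
  field
    time   : ℕ
    time≤T : time ≤ T
    runs   : Runs P W time c d
    halted : fetch P (pc d) ≡ just halt

-- Words of O(log n) bits: W is polynomial in n.  The exponent is positive
-- so that the input consists of words.
wordBound : ℕ → ℕ → ℕ
wordBound k n = (2 + n) ^ suc k

_∈O_ : Rel (ℕ → ℕ) 0ℓ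
f ∈O g = ∃[ c ] ∃[ n₀ ] (∀ n → n₀ ≤ n → f n ≤ c * g n)

label : ∀ {n} → Fin n → ℕ
label i = suc (toℕ i)

-- Memory cell i holds π(i) for 1 ≤ i ≤ n, register 0 holds n, and
-- everything else is 0.
inputMemory : ∀ {n} → Permutation′ n → ℕ → ℕ
inputMemory π zero = 0
inputMemory {n} π (suc a) with a <? n
... | yes a<n = label (π ⟨$⟩ʳ fromℕ< a<n)
... | no  _   = 0

initial : ∀ {n} → Permutation′ n → Configuration
initial {n} π = ⟨ 0 , (λ _ → 0) [ 0 ≔ n ] , inputMemory π ⟩

-- Register 0 holds the number of edges and register 1 the address of an
-- array that lists the two ends of each edge consecutively.
record Outputs {n} (d : Configuration) (M : List (Fin n × Fin n)) : Set where
  field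
    size   : reg d 0 ≡ length M
    first  : ∀ i → mem d (reg d 1 + 2 * toℕ i) ≡ label (proj₁ (lookup M i))
    second : ∀ i → mem d (reg d 1 + 2 * toℕ i + 1) ≡ label (proj₂ (lookup M i))

{-# OPTIONS --safe #-}

-- Order the vertices by u ⊏ v when both the value and the position of u are
-- smaller; two vertices are adjacent iff they are incomparable.  Hence two
-- edges of an induced matching are comparable end by end, one lies entirely
-- below the other, and an induced matching is a chain of edges.  Let
-- best x y be the maximal length of a chain with values ≤ x and positions ≤ y.
-- The only edge whose larger value is x and whose larger position is y joins
-- π(y) to x, so
--   best x y = max (best x (y − 1)) (best (x − 1) y) (1 + best (π(y) − 1) (π⁻¹(x) − 1)),
-- the last term only if π(y) < x and π⁻¹(x) < y.  This table of size O(n²) is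
-- filled in constant time per entry, and an optimal chain is read off by
-- walking back from (n , n) in O(n) steps.
module Submission where

open import Defs
open import Data.Bool.Base using (true; false)
open import Data.Empty using (⊥)
open import Data.Fin.Base using (Fin; zero; suc; toℕ; fromℕ<)
open import Data.Fin.Permutation using (Permutation′; _⟨$⟩ʳ_; _⟨$⟩ˡ_; flip; inverseˡ; inverseʳ)
open import Data.Fin.Properties using (toℕ<n; toℕ-injective; fromℕ<-toℕ; toℕ-fromℕ<)
open import Data.Integer.Base as ℤ using (+_; -[1+_]; +[1+_]; -<+)
import Data.Integer.Properties as ℤ
open import Data.List.Base using (List; []; _∷_; _++_; length; lookup; map; replicate)
open import Data.List.Membership.Propositional using (_∈_; find)
open import Data.List.Membership.Propositional.Properties using (∈-∃++)
open import Data.List.Properties using (length-map)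
open import Data.List.Relation.Binary.Permutation.Propositional using (_↭_; ↭⇒↭ₛ)
open import Data.List.Relation.Binary.Permutation.Propositional.Properties using (shift; All-resp-↭; ↭-length; ∈-resp-↭)
import Data.List.Relation.Binary.Permutation.Setoid.Properties as Permutationₛ
open import Data.List.Relation.Unary.All as All using (All; []; _∷_)
import Data.List.Relation.Unary.All.Properties as All
open import Data.List.Relation.Unary.AllPairs using (AllPairs; []; _∷_)
import Data.List.Relation.Unary.AllPairs.Properties as AllPairs
open import Data.List.Relation.Unary.Any using (here; there; any?)
open import Data.Maybe.Base using (Maybe; just; nothing)
open import Data.Nat.Base
open import Data.Nat.Properties
open import Data.Nat.Tactic.RingSolver using (solve-∀)
open import Data.Product.Base using (_×_; _,_; proj₁; proj₂; ∃-syntax; Σ-syntax)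
open import Data.Sum.Base using (_⊎_; inj₁; inj₂; swap)
open import Function.Base using (_∘_)
open import Relation.Binary.Definitions using (tri<; tri≈; tri>)
open import Relation.Binary.PropositionalEquality
open import Relation.Nullary.Decidable using (Dec; does; yes; no; dec-true; dec-false)
open import Relation.Nullary.Negation using (¬_; contradiction)

-- Memory updates, and register files as lists.

update-same : ∀ (μ : ℕ → ℕ) a x → (μ [ a ≔ x ]) a ≡ x
update-same μ a x rewrite dec-true (a ≟ a) refl = refl

update-other : ∀ (μ : ℕ → ℕ) {a b} x → b ≢ a → (μ [ a ≔ x ]) b ≡ μ b
update-other μ {a} {b} x b≢a rewrite dec-false (b ≟ a) b≢a = refl

update-cong : ∀ {ρ σ : ℕ → ℕ} r {x y} → (∀ i → ρ i ≡ σ i) → x ≡ y →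
              ∀ i → (ρ [ r ≔ x ]) i ≡ (σ [ r ≔ y ]) i
update-cong r ρ≗σ x≡y i with does (i ≟ r)
... | true  = x≡y
... | false = ρ≗σ i

-- A finite list stands for a total register file, with 0 beyond its end, so that reads and writes
-- at constant registers reduce by computation.
nth : List ℕ → ℕ → ℕ
nth []      _       = 0
nth (x ∷ _) zero    = x
nth (_ ∷ v) (suc i) = nth v i

set : List ℕ → ℕ → ℕ → List ℕ
set []      zero    x = x ∷ []
set []      (suc r) x = 0 ∷ set [] r x
set (_ ∷ v) zero    x = x ∷ v
set (y ∷ v) (suc r) x = y ∷ set v r x

nth-set : ∀ v r x i → (nth v [ r ≔ x ]) i ≡ nth (set v r x) i
nth-set []      zero    x zero    = refl
nth-set []      zero    x (suc i) = refl
nth-set []      (suc r) x zero    = refl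
nth-set []      (suc r) x (suc i) = nth-set [] r x i
nth-set (_ ∷ v) zero    x zero    = refl
nth-set (_ ∷ v) zero    x (suc i) = refl
nth-set (_ ∷ v) (suc r) x zero    = refl
nth-set (_ ∷ v) (suc r) x (suc i) = nth-set v r x i

-- Weakest preconditions with a time budget.

module Verification (P : Program) (W : ℕ) (Q : Configuration → Set) where

  -- Register files are functions that agree with the list `v` only pointwise; ranging over all such
  -- `ρ` avoids function extensionality.
  record Terminates (T : ℕ) (l : Label) (v : List ℕ) (μ : ℕ → ℕ) : Set where
    constructor terminates
    field
      from : ∀ ρ → (∀ i → ρ i ≡ nth v i) →
             ∃[ d ] HaltsWithin P W T ⟨ l , ρ , μ ⟩ d × Q d

  open Terminates

  -- The computed value z of an instruction is an argument, so that a proof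
  -- can choose the form in which later values depend on it.
  wp : Instruction → ℕ → Label → List ℕ → (ℕ → ℕ) → Set
  wp (const r k) T l v μ = k < W × Terminates T (suc l) (set v r k) μ
  wp (copy r s)  T l v μ = Terminates T (suc l) (set v r (nth v s)) μ
  wp (add r s t) T l v μ =
    ∃[ z ] nth v s + nth v t ≡ z × z < W × Terminates T (suc l) (set v r z) μ
  wp (sub r s t) T l v μ =
    ∃[ z ] nth v s ∸ nth v t ≡ z × Terminates T (suc l) (set v r z) μ
  wp (load r s)  T l v μ =
    ∃[ z ] μ (nth v s) ≡ z × Terminates T (suc l) (set v r z) μ
  wp (store r s) T l v μ = Terminates T (suc l) v (μ [ nth v r ≔ nth v s ])
  wp (jump l′)   T l v μ = Terminates T l′ v μ
  wp (jlt r s l′) T l v μ =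
    (nth v r < nth v s → Terminates T l′ v μ) ×
    (nth v s ≤ nth v r → Terminates T (suc l) v μ)
  wp halt        T l v μ = ∀ ρ → (∀ i → ρ i ≡ nth v i) → Q ⟨ l , ρ , μ ⟩

  wpAt : Maybe Instruction → ℕ → Label → List ℕ → (ℕ → ℕ) → Set
  wpAt (just i) = wp i
  wpAt nothing  = λ _ _ _ _ → ⊥

  private
    prepend : ∀ {T c c′ i} → fetch P (pc c) ≡ just i → Executes W i c c′ →
              ∃[ d ] HaltsWithin P W T c′ d × Q d → ∃[ d ] HaltsWithin P W (suc T) c d × Q d
    prepend eq ex (d , h , q) = d , record
      { time   = suc (HaltsWithin.time h)
      ; time≤T = s≤s (HaltsWithin.time≤T h)
      ; runs   = step eq ex (HaltsWithin.runs h)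
      ; halted = HaltsWithin.halted h
      } , q

    assign : ∀ {ρ} v r {x z} → (∀ i → ρ i ≡ nth v i) → x ≡ z →
             ∀ i → (ρ [ r ≔ x ]) i ≡ nth (set v r z) i
    assign v r {z = z} ρ≗v x≡z i = trans (update-cong r ρ≗v x≡z i) (nth-set v r z i)

    execute : ∀ i {T l v μ} → fetch P l ≡ just i → wp i T l v μ → Terminates (suc T) l v μ
    execute (const r k) {v = v} eq (k<W , t) = terminates λ ρ ρ≗v →
      prepend eq (const k<W) (from t _ (assign v r ρ≗v refl))
    execute (copy r s) {v = v} eq t = terminates λ ρ ρ≗v →
      prepend eq copy (from t _ (assign v r ρ≗v (ρ≗v s)))
    execute (add r s t) {v = v} eq (z , z≡ , z<W , k) = terminates λ ρ ρ≗v →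
      let sum≡z = trans (cong₂ _+_ (ρ≗v s) (ρ≗v t)) z≡ in
      prepend eq (add (subst (_< W) (sym sum≡z) z<W)) (from k _ (assign v r ρ≗v sum≡z))
    execute (sub r s t) {v = v} eq (z , z≡ , k) = terminates λ ρ ρ≗v →
      prepend eq sub (from k _ (assign v r ρ≗v (trans (cong₂ _∸_ (ρ≗v s) (ρ≗v t)) z≡)))
    execute (load r s) {v = v} {μ} eq (z , z≡ , k) = terminates λ ρ ρ≗v →
      prepend eq load (from k _ (assign v r ρ≗v (trans (cong μ (ρ≗v s)) z≡)))
    execute (store r s) {T} {l} {v} {μ} eq k = terminates λ ρ ρ≗v →
      -- The memory produced by the machine mentions `ρ`, the one in the precondition mentions `v`;
      -- address and value are exchanged by substitution.
      prepend {T} eq store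
        (subst₂ (λ a x → ∃[ d ] HaltsWithin P W T ⟨ suc l , ρ , μ [ a ≔ x ] ⟩ d × Q d)
                (sym (ρ≗v r)) (sym (ρ≗v s)) (from k ρ ρ≗v))
    execute (jump l′) eq k = terminates λ ρ ρ≗v → prepend eq jump (from k ρ ρ≗v)
    execute (jlt r s l′) {v = v} eq (k< , k≥) = terminates λ ρ ρ≗v → branch ρ ρ≗v
      where
      branch : ∀ ρ → (∀ i → ρ i ≡ nth v i) → _
      branch ρ ρ≗v with ρ r <? ρ s
      ... | yes lt = prepend eq (jlt-< lt) (from (k< (subst₂ _<_ (ρ≗v r) (ρ≗v s) lt)) ρ ρ≗v)
      ... | no ¬lt = prepend eq (jlt-≮ ¬lt)
                       (from (k≥ (subst₂ _≤_ (ρ≗v s) (ρ≗v r) (≮⇒≥ ¬lt))) ρ ρ≗v)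
    execute halt eq k = terminates λ ρ ρ≗v →
      _ , record { time = 0 ; time≤T = z≤n ; runs = done ; halted = eq } , k ρ ρ≗v

  -- Performs one instruction: for a concrete program and label, `fetch P l` reduces and `wpAt`
  -- unfolds to the precondition of that instruction. A label outside the program leaves `⊥` to
  -- prove.
  run : ∀ {T l v μ} → wpAt (fetch P l) T l v μ → Terminates (suc T) l v μ
  run {l = l} w with fetch P l in eq
  ... | just i = execute i eq w

  relax : ∀ {T T′ l v μ} → T ≤ T′ → Terminates T l v μ → Terminates T′ l v μ
  relax T≤T′ t = terminates λ ρ ρ≗v →
    let d , h , q = from t ρ ρ≗v in
    d , record
      { time   = HaltsWithin.time h
      ; time≤T = ≤-trans (HaltsWithin.time≤T h) T≤T′
      ; runs   = HaltsWithin.runs h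
      ; halted = HaltsWithin.halted h
      } , q

-- The recurrence for the table.

module Recurrence (p q : ℕ → ℕ) where

  candidate : (ℕ → ℕ → ℕ) → ℕ → ℕ → ℕ
  candidate h x y with p y <? x | q x <? y
  ... | yes _ | yes _ = suc (h (p y ∸ 1) (q x ∸ 1))
  ... | yes _ | no _  = 0
  ... | no _  | _     = 0

  -- The argument `k` is fuel, since the jump to `p y ∸ 1` and `q x ∸ 1` is not structural; `x + y`
  -- suffices because every recursive call lowers this sum.
  approx : ℕ → ℕ → ℕ → ℕ
  approx zero    _       _       = 0
  approx (suc k) zero    _       = 0
  approx (suc k) (suc x) zero    = 0
  approx (suc k) (suc x) (suc y) =
    approx k (suc x) y ⊔ approx k x (suc y) ⊔ candidate (approx k) (suc x) (suc y)

  best : ℕ → ℕ → ℕ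
  best x y = approx (x + y) x y

  -- The two guards place the arguments passed to `h` strictly below `x` and `y`.
  candidate-cong : ∀ {h h′} x y → (∀ {a b} → a < x → b < y → h a b ≡ h′ a b) →
                   candidate h x y ≡ candidate h′ x y
  candidate-cong x y h≡h′ with p y <? x | q x <? y
  ... | yes py<x | yes qx<y =
    cong suc (h≡h′ (≤-<-trans (m∸n≤m _ 1) py<x) (≤-<-trans (m∸n≤m _ 1) qx<y))
  ... | yes _ | no _ = refl
  ... | no _  | _    = refl

  -- Each call lowers the sum of the arguments by at least one, as it does the fuel. This yields the
  -- recurrence for `best`, whose fuel varies with its arguments.
  approx-stable : ∀ k k′ x y → x + y ≤ k → x + y ≤ k′ → approx k x y ≡ approx k′ x y
  approx-stable zero    zero     x       y       _  _   = refl
  approx-stable zero    (suc k′) zero    y       _  _   = refl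
  approx-stable (suc k) zero     zero    y       _  _   = refl
  approx-stable (suc k) (suc k′) zero    y       _  _   = refl
  approx-stable (suc k) (suc k′) (suc x) zero    _  _   = refl
  approx-stable (suc k) (suc k′) (suc x) (suc y) (s≤s le) (s≤s le′) =
    cong₂ _⊔_
      (cong₂ _⊔_ (approx-stable k k′ (suc x) y (left le) (left le′))
                 (approx-stable k k′ x (suc y) le le′))
      (candidate-cong (suc x) (suc y) λ a<x b<y →
        approx-stable k k′ _ _ (both (s≤s⁻¹ a<x) (s≤s⁻¹ b<y) le) (both (s≤s⁻¹ a<x) (s≤s⁻¹ b<y) le′))
    where
    left : ∀ {m} → x + suc y ≤ m → suc x + y ≤ m
    left {m} = subst (_≤ m) (+-suc x y)
    both : ∀ {a b m} → a ≤ x → b ≤ y → x + suc y ≤ m → a + b ≤ m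
    both a≤x b≤y = ≤-trans (+-mono-≤ a≤x (m≤n⇒m≤1+n b≤y))

  best-zeroˡ : ∀ y → best 0 y ≡ 0
  best-zeroˡ zero    = refl
  best-zeroˡ (suc y) = refl

  best-zeroʳ : ∀ x → best x 0 ≡ 0
  best-zeroʳ zero    = refl
  best-zeroʳ (suc x) = refl

  best-suc : ∀ x y → best (suc x) (suc y) ≡
             best (suc x) y ⊔ best x (suc y) ⊔ candidate best (suc x) (suc y)
  best-suc x y = cong₂ _⊔_
    (cong (_⊔ best x (suc y)) (approx-stable _ _ (suc x) y (≤-reflexive (sym (+-suc x y))) ≤-refl))
    (candidate-cong (suc x) (suc y) λ a<x b<y →
      approx-stable _ _ _ _ (+-mono-≤ (s≤s⁻¹ a<x) (<⇒≤ b<y)) ≤-refl)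

  best-suc-≥ʳ : ∀ x y → best (suc x) y ≤ best (suc x) (suc y)
  best-suc-≥ʳ x y = subst (best (suc x) y ≤_) (sym (best-suc x y))
    (≤-trans (m≤m⊔n (best (suc x) y) (best x (suc y))) (m≤m⊔n _ _))

  best-suc-≥ˡ : ∀ x y → best x (suc y) ≤ best (suc x) (suc y)
  best-suc-≥ˡ x y = subst (best x (suc y) ≤_) (sym (best-suc x y))
    (≤-trans (m≤n⊔m (best (suc x) y) (best x (suc y))) (m≤m⊔n _ _))

  best-suc-≥-candidate : ∀ x y → candidate best (suc x) (suc y) ≤ best (suc x) (suc y)
  best-suc-≥-candidate x y = subst (candidate best (suc x) (suc y) ≤_) (sym (best-suc x y))
    (m≤n⊔m (best (suc x) y ⊔ best x (suc y)) _)

  candidate-yes : ∀ {x y} → p y < x → q x < y → candidate best x y ≡ suc (best (p y ∸ 1) (q x ∸ 1))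
  candidate-yes {x} {y} py<x qx<y with p y <? x | q x <? y
  ... | yes _   | yes _   = refl
  ... | yes _   | no qx≮y = contradiction qx<y qx≮y
  ... | no py≮x | _       = contradiction py<x py≮x

  candidate-noˡ : ∀ {x y} → x ≤ p y → candidate best x y ≡ 0
  candidate-noˡ {x} {y} x≤py with p y <? x | q x <? y
  ... | yes py<x | _ = contradiction x≤py (<⇒≱ py<x)
  ... | no _     | _ = refl

  candidate-noʳ : ∀ {x y} → y ≤ q x → candidate best x y ≡ 0
  candidate-noʳ {x} {y} y≤qx with p y <? x | q x <? y
  ... | yes _ | yes qx<y = contradiction y≤qx (<⇒≱ qx<y)
  ... | yes _ | no _     = refl
  ... | no _  | _        = refl

  -- The candidate adds one to a value bounded by `p (suc y) ∸ 1`, and the guard keeps this at most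
  -- `x`. The bound makes table entries fit into words.
  approx≤ : ∀ k x y → approx k x y ≤ x
  approx≤ zero    x       y    = z≤n
  approx≤ (suc k) zero    y    = z≤n
  approx≤ (suc k) (suc x) zero = z≤n
  approx≤ (suc k) (suc x) (suc y) =
    ⊔-lub (⊔-lub (approx≤ k (suc x) y) (m≤n⇒m≤1+n (approx≤ k x (suc y)))) bounded
    where
    bounded : candidate (approx k) (suc x) (suc y) ≤ suc x
    bounded with p (suc y) <? suc x | q (suc x) <? suc y
    ... | yes (s≤s py≤x) | yes _ =
      s≤s (≤-trans (approx≤ k (p (suc y) ∸ 1) (q (suc x) ∸ 1)) (≤-trans (m∸n≤m (p (suc y)) 1) py≤x))
    ... | yes _ | no _ = z≤n
    ... | no _  | _    = z≤n

  best≤ : ∀ x y → best x y ≤ x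
  best≤ x y = approx≤ (x + y) x y

  -- An entry exceeding both neighbours must come from the candidate, which is then positive, so
  -- both guards hold. This tells the traceback when to emit an edge.
  best-attained : ∀ x y → best (suc x) y < best (suc x) (suc y) →
                  best x (suc y) < best (suc x) (suc y) →
                  p (suc y) < suc x × q (suc x) < suc y ×
                  best (suc x) (suc y) ≡ suc (best (p (suc y) ∸ 1) (q (suc x) ∸ 1))
  best-attained x y lt₁ lt₂ = decide (p (suc y) <? suc x) (q (suc x) <? suc y)
    where
    is-candidate : best (suc x) (suc y) ≡ candidate best (suc x) (suc y)
    is-candidate with ⊔-sel (best (suc x) y ⊔ best x (suc y)) (candidate best (suc x) (suc y))
    ... | inj₂ eq = trans (best-suc x y) eq
    ... | inj₁ eq = contradiction (trans (best-suc x y) eq) (>⇒≢ (⊔-pres-<m lt₁ lt₂))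
    positive : candidate best (suc x) (suc y) ≢ 0
    positive eq = n≮0 (subst (best (suc x) y <_) (trans is-candidate eq) lt₁)
    decide : Dec (p (suc y) < suc x) → Dec (q (suc x) < suc y) → _
    decide (yes py<x) (yes qx<y) = py<x , qx<y , trans is-candidate (candidate-yes py<x qx<y)
    decide (yes _) (no qx≮y) = contradiction (candidate-noʳ (≮⇒≥ qx≮y)) positive
    decide (no py≮x) _       = contradiction (candidate-noˡ (≮⇒≥ py≮x)) positive

-- Signs of products of integer differences.

difference-neg : ∀ {a b} → a < b → ∃[ k ] + a ℤ.- + b ≡ -[1+ k ]
difference-neg {a} {b} a<b with b ∸ a in eq
... | zero  = contradiction eq (m>n⇒m∸n≢0 a<b)
... | suc k = k , trans (ℤ.m-n≡m⊖n a b) (trans (ℤ.⊖-< a<b) (cong (ℤ.-_ ∘ +_) eq))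

difference-pos : ∀ {a b} → b < a → ∃[ k ] + a ℤ.- + b ≡ +[1+ k ]
difference-pos {a} {b} b<a with a ∸ b in eq
... | zero  = contradiction eq (m>n⇒m∸n≢0 b<a)
... | suc k = k , trans (ℤ.m-n≡m⊖n a b) (trans (ℤ.⊖-≥ (<⇒≤ b<a)) (cong +_ eq))

Opposite : ℕ → ℕ → ℕ → ℕ → Set
Opposite a b c d = (a < b × d < c) ⊎ (b < a × c < d)

product-neg⁺ : ∀ {a b c d} → Opposite a b c d → (+ a ℤ.- + b) ℤ.* (+ c ℤ.- + d) ℤ.< + 0
product-neg⁺ (inj₁ (a<b , d<c))
  with _ , eq ← difference-neg a<b | _ , eq′ ← difference-pos d<c rewrite eq | eq′ = -<+
product-neg⁺ (inj₂ (b<a , c<d))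
  with _ , eq ← difference-pos b<a | _ , eq′ ← difference-neg c<d rewrite eq | eq′ = -<+

product-neg⁻ : ∀ a b c d → (+ a ℤ.- + b) ℤ.* (+ c ℤ.- + d) ℤ.< + 0 → Opposite a b c d
product-neg⁻ a b c d neg with <-cmp a b | <-cmp c d
... | tri< a<b _ _ | tri> _ _ d<c = inj₁ (a<b , d<c)
... | tri> _ _ b<a | tri< c<d _ _ = inj₂ (b<a , c<d)
... | tri≈ _ refl _ | _ rewrite ℤ.+-inverseʳ (+ a) = contradiction neg (ℤ.<-irrefl refl)
... | tri< _ _ _ | tri≈ _ refl _
  rewrite ℤ.+-inverseʳ (+ c) | ℤ.*-zeroʳ (+ a ℤ.- + b) = contradiction neg (ℤ.<-irrefl refl)
... | tri> _ _ _ | tri≈ _ refl _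
  rewrite ℤ.+-inverseʳ (+ c) | ℤ.*-zeroʳ (+ a ℤ.- + b) = contradiction neg (ℤ.<-irrefl refl)
... | tri< a<b _ _ | tri< c<d _ _
  with _ , eq ← difference-neg a<b | _ , eq′ ← difference-neg c<d rewrite eq | eq′ with ℤ.+<+ () ← neg
... | tri> _ _ b<a | tri> _ _ d<c
  with _ , eq ← difference-pos b<a | _ , eq′ ← difference-pos d<c rewrite eq | eq′ with ℤ.+<+ () ← neg

AllPairs-map-∈ : ∀ {A : Set} {R S : A → A → Set} {xs} →
                 (∀ {x y} → x ∈ xs → y ∈ xs → R x y → S x y) → AllPairs R xs → AllPairs S xs
AllPairs-map-∈ f []         = []
AllPairs-map-∈ f (rs ∷ rss) =
  All.tabulate (λ y∈ → f (here refl) (there y∈) (All.lookup rs y∈)) ∷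
  AllPairs-map-∈ (λ x∈ y∈ → f (there x∈) (there y∈)) rss

-- The input memory and its inverse.

inputMemory-label : ∀ {n} (π : Permutation′ n) i → inputMemory π (label i) ≡ label (π ⟨$⟩ʳ i)
inputMemory-label {n} π i with toℕ i <? n
... | yes i<n = cong (label ∘ (π ⟨$⟩ʳ_)) (fromℕ<-toℕ i i<n)
... | no  i≮n = contradiction (toℕ<n i) i≮n

inputMemory-beyond : ∀ {n} (π : Permutation′ n) {a} → n < a → inputMemory π a ≡ 0
inputMemory-beyond {n} π {suc a} (s≤s n≤a) with a <? n
... | yes a<n = contradiction n≤a (<⇒≱ a<n)
... | no  _   = refl

inputMemory≤ : ∀ {n} (π : Permutation′ n) a → inputMemory π a ≤ n
inputMemory≤ π zero = z≤n
inputMemory≤ {n} π (suc a) with a <? n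
... | yes _ = toℕ<n _
... | no  _ = z≤n

label-fromℕ< : ∀ {n x} (x<n : x < n) → label (fromℕ< x<n) ≡ suc x
label-fromℕ< x<n = cong suc (toℕ-fromℕ< x<n)

inputMemory-inverse : ∀ {n} (π : Permutation′ n) {a} → a ≤ n →
                      inputMemory (flip π) (inputMemory π a) ≡ a
-- Cell 0 holds 0 for both permutations, so the inverse law extends to the index 0, which the memory
-- invariants include.
inputMemory-inverse π {zero}  _   = refl
inputMemory-inverse π {suc a} a<n = begin
  q (p (suc a))              ≡⟨ cong (q ∘ p) (label-fromℕ< a<n) ⟨
  q (p (label i))            ≡⟨ cong q (inputMemory-label π i) ⟩
  q (label (π ⟨$⟩ʳ i))       ≡⟨ inputMemory-label (flip π) (π ⟨$⟩ʳ i) ⟩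
  label (π ⟨$⟩ˡ (π ⟨$⟩ʳ i))  ≡⟨ cong label (inverseˡ π) ⟩
  label i                    ≡⟨ label-fromℕ< a<n ⟩
  suc a                      ∎
  where
  open ≡-Reasoning
  p q : ℕ → ℕ
  p = inputMemory π
  q = inputMemory (flip π)
  i : Fin _
  i = fromℕ< a<n

-- Inversions, separation and independence.

module Combinatorics {n} (π : Permutation′ n) where

  Edge : Set
  Edge = Fin n × Fin n

  p q : ℕ → ℕ
  p = inputMemory π
  q = inputMemory (flip π)

  open Recurrence p q public

  position : Fin n → ℕ
  position v = label (π ⟨$⟩ˡ v)

  Inversion : Edge → Set
  Inversion (u , v) = label u < label v × position v < position u

  infix 4 _≺_

  -- In an inversion `v` has the larger value and `u` the larger position, so one inequality per
  -- coordinate puts both ends of the first edge below both ends of the second.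
  _≺_ : Edge → Edge → Set
  (u₁ , v₁) ≺ (u₂ , v₂) = label v₁ < label u₂ × position u₁ < position v₂

  Separated : Edge → Edge → Set
  Separated e f = e ≺ f ⊎ f ≺ e

  Within : ℕ → ℕ → Edge → Set
  Within x y (u , v) = label v ≤ x × position u ≤ y

  E : Fin n → Fin n → Set
  E = PermutationGraph π

  edge⁺ : ∀ {u v} → Inversion (u , v) → E u v
  edge⁺ (s≤s u<v , s≤s v<u) = product-neg⁺ (inj₁ (u<v , v<u))

  edge⁻ : ∀ u v → E u v → Inversion (u , v) ⊎ Inversion (v , u)
  edge⁻ u v e with product-neg⁻ (toℕ u) (toℕ v) (toℕ (π ⟨$⟩ˡ u)) (toℕ (π ⟨$⟩ˡ v)) e
  ... | inj₁ (a , b) = inj₁ (s≤s a , s≤s b)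
  ... | inj₂ (a , b) = inj₂ (s≤s a , s≤s b)

  infix 4 _⊏_

  _⊏_ : Fin n → Fin n → Set
  u ⊏ v = label u < label v × position u < position v

  ⊏⇒¬edge : ∀ {u v} → u ⊏ v → ¬ E u v
  ⊏⇒¬edge {u} {v} (u<v , pu<pv) e with edge⁻ u v e
  ... | inj₁ (_ , pv<pu) = <-asym pu<pv pv<pu
  ... | inj₂ (v<u , _)   = <-asym u<v v<u

  -- Opposite orders in value and position would give an edge, and equality in either coordinate
  -- forces `u ≡ v` because `π` is a bijection.
  ¬edge⇒comparable : ∀ {u v} → u ≢ v → ¬ E u v → u ⊏ v ⊎ v ⊏ u
  ¬edge⇒comparable {u} {v} u≢v ¬e with <-cmp (label u) (label v) | <-cmp (position u) (position v)
  ... | tri< a _ _ | tri< b _ _ = inj₁ (a , b)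
  ... | tri> _ _ a | tri> _ _ b = inj₂ (a , b)
  ... | tri< a _ _ | tri> _ _ b = contradiction (edge⁺ (a , b)) ¬e
  ... | tri> _ _ a | tri< b _ _ = contradiction (product-neg⁺ (inj₂ (s≤s⁻¹ a , s≤s⁻¹ b))) ¬e
  ... | tri≈ _ a _ | _ = contradiction (toℕ-injective (suc-injective a)) u≢v
  ... | _ | tri≈ _ b _ = contradiction
    (trans (sym (inverseʳ π)) (trans (cong (π ⟨$⟩ʳ_) (toℕ-injective (suc-injective b))) (inverseʳ π))) u≢v

  edge-sym : ∀ u v → E u v → E v u
  edge-sym u v e with edge⁻ u v e
  ... | inj₁ (s≤s a , s≤s b) = product-neg⁺ (inj₂ (a , b))
  ... | inj₂ (s≤s a , s≤s b) = product-neg⁺ (inj₁ (a , b))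

  Independent : Edge → Edge → Set
  Independent (u₁ , v₁) (u₂ , v₂) = ¬ E u₁ u₂ × ¬ E u₁ v₂ × ¬ E v₁ u₂ × ¬ E v₁ v₂

  -- Every end of e is comparable to every end of f, whereas the ends of one
  -- edge are incomparable; so e lies entirely below or entirely above f.
  independent⇒separated : ∀ e f → Inversion e → Inversion f → Independent e f → Separated e f
  independent⇒separated (u₁ , v₁) (u₂ , v₂) (u₁<v₁ , pv₁<pu₁) (u₂<v₂ , pv₂<pu₂)
    (¬u₁u₂ , ¬u₁v₂ , ¬v₁u₂ , ¬v₁v₂)
    -- The compared ends differ: if they coincided, the second edge itself would join an end of the
    -- first to an end of the second.
    with ¬edge⇒comparable {v₁} {u₂} (λ { refl → ¬v₁v₂ (edge⁺ (u₂<v₂ , pv₂<pu₂)) }) ¬v₁u₂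
       | ¬edge⇒comparable {u₁} {v₂} (λ { refl → ¬u₁u₂ (edge-sym u₂ v₂ (edge⁺ (u₂<v₂ , pv₂<pu₂))) }) ¬u₁v₂
  ... | inj₁ (v₁<u₂ , _) | inj₁ (_ , pu₁<pv₂) = inj₁ (v₁<u₂ , pu₁<pv₂)
  ... | inj₂ (_ , pu₂<pv₁) | inj₂ (v₂<u₁ , _) = inj₂ (v₂<u₁ , pu₂<pv₁)
  -- If the two comparisons disagree, one coordinate closes a cycle: here the values
  -- `v₁ < u₂ < v₂ < u₁ < v₁`, in the next case the positions.
  ... | inj₁ (v₁<u₂ , _) | inj₂ (v₂<u₁ , _) =
    contradiction (<-trans v₁<u₂ (<-trans u₂<v₂ v₂<u₁)) (<-asym u₁<v₁)
  ... | inj₂ (_ , pu₂<pv₁) | inj₁ (_ , pu₁<pv₂)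
    = contradiction (<-trans pu₂<pv₁ (<-trans pv₁<pu₁ pu₁<pv₂)) (<-asym pv₂<pu₂)

  -- A matching lists unordered pairs, whereas separation is stated for edges with the smaller value
  -- first.
  orient : Edge → Edge
  orient (u , v) with label u <? label v
  ... | yes _ = u , v
  ... | no  _ = v , u

  orient-inversion : ∀ u v → E u v → Inversion (orient (u , v))
  orient-inversion u v e with label u <? label v | edge⁻ u v e
  ... | yes _   | inj₁ inv       = inv
  ... | yes u<v | inj₂ (v<u , _) = contradiction u<v (<-asym v<u)
  ... | no u≮v  | inj₁ (u<v , _) = contradiction u<v u≮v
  ... | no _    | inj₂ inv       = inv

  orient-independent : ∀ e f → Independent e f → Independent (orient e) (orient f)
  orient-independent (u₁ , v₁) (u₂ , v₂) (a , b , c , d)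
    with label u₁ <? label v₁ | label u₂ <? label v₂
  ... | yes _ | yes _ = a , b , c , d
  ... | yes _ | no _  = b , a , d , c
  ... | no _  | yes _ = c , d , a , b
  ... | no _  | no _  = d , c , b , a

  -- The upper bound on induced matchings.

  separated-sym : ∀ {e f} → Separated e f → Separated f e
  separated-sym = swap

  -- Separation is symmetric, hence survives reordering; moving `e` to the front exposes its
  -- separation from all other edges.
  extract : ∀ {e M} → e ∈ M → AllPairs Separated M →
            ∃[ M′ ] M ↭ e ∷ M′ × All (Separated e) M′ × AllPairs Separated M′
  extract e∈M sep with ys , zs , refl ← ∈-∃++ e∈M
    with s ∷ ss ← Permutationₛ.AllPairs-resp-↭ (setoid Edge) separated-sym
                    (subst (Separated _) , subst (λ e → Separated e _))
                    (↭⇒↭ₛ (shift _ ys zs)) sep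
    = ys ++ zs , shift _ ys zs , s , ss

  p-position : ∀ u → p (position u) ≡ label u
  p-position u = trans (inputMemory-label π (π ⟨$⟩ˡ u)) (cong label (inverseʳ π))

  q-label : ∀ v → q (label v) ≡ position v
  q-label = inputMemory-label (flip π)

  -- The extremes `suc x` and `suc y` determine the other two coordinates through `q` and `p`, so
  -- the candidate term is the one for this edge.
  best-step : ∀ {x y} u v → Inversion (u , v) → label v ≡ suc x → position u ≡ suc y →
              suc (best (toℕ u) (toℕ (π ⟨$⟩ˡ v))) ≤ best (suc x) (suc y)
  best-step {x} {y} u v (u<v , pv<pu) v≡x pu≡y = begin
    suc (best (toℕ u) (toℕ (π ⟨$⟩ˡ v)))         ≡⟨ cong₂ (λ a b → suc (best (a ∸ 1) (b ∸ 1))) p≡ q≡ ⟨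
    suc (best (p (suc y) ∸ 1) (q (suc x) ∸ 1))  ≡⟨ candidate-yes (subst₂ _<_ (sym p≡) v≡x u<v)
                                                     (subst₂ _<_ (sym q≡) pu≡y pv<pu) ⟨
    candidate best (suc x) (suc y)              ≤⟨ best-suc-≥-candidate x y ⟩
    best (suc x) (suc y)                        ∎
    where
    open ≤-Reasoning
    p≡ : p (suc y) ≡ label u
    p≡ = trans (cong p (sym pu≡y)) (p-position u)
    q≡ : q (suc x) ≡ position v
    q≡ = trans (cong q (sym v≡x)) (q-label v)

  -- If an edge attains the bound x on values and an edge attains the bound y
  -- on positions, both are one edge by separation, and all others lie below it.
  length≤best : ∀ k x y → x + y ≤ k → ∀ M → All Inversion M → All (Within x y) M →
                AllPairs Separated M → length M ≤ best x y
  length≤best k x y _ [] _ _ _ = z≤n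
  length≤best k zero y _ (_ ∷ _) _ ((() , _) ∷ _) _
  length≤best k (suc x) zero _ (_ ∷ _) _ ((_ , ()) ∷ _) _
  length≤best (suc k) (suc x) (suc y) (s≤s le) M@(_ ∷ _) inv within sep
    with any? (λ (u , v) → label v ≟ suc x) M | any? (λ (u , v) → position u ≟ suc y) M
  ... | no none | _ = begin
    length M             ≤⟨ length≤best k x (suc y) le M inv within′ sep ⟩
    best x (suc y)       ≤⟨ best-suc-≥ˡ x y ⟩
    best (suc x) (suc y) ∎
    where
    open ≤-Reasoning
    within′ : All (Within x (suc y)) M
    within′ = All.zipWith (λ (v≢x , v≤x , u≤y) → s≤s⁻¹ (≤∧≢⇒< v≤x v≢x) , u≤y)
                          (All.¬Any⇒All¬ M none , within)
  ... | yes _ | no none = begin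
    length M             ≤⟨ length≤best k (suc x) y (subst (_≤ k) (+-suc x y) le) M inv within′ sep ⟩
    best (suc x) y       ≤⟨ best-suc-≥ʳ x y ⟩
    best (suc x) (suc y) ∎
    where
    open ≤-Reasoning
    within′ : All (Within (suc x) y) M
    within′ = All.zipWith (λ (u≢y , v≤x , u≤y) → v≤x , s≤s⁻¹ (≤∧≢⇒< u≤y u≢y))
                          (All.¬Any⇒All¬ M none , within)
  ... | yes anyˣ | yes anyʸ
    with (u , v) , e∈M , v≡x ← find anyˣ | (u′ , v′) , f∈M , u′≡y ← find anyʸ
    with M′ , M↭ , seps , sep′ ← extract e∈M sep
    with inv₀ ∷ inv′ ← All-resp-↭ M↭ inv | (v≤x , u≤y) ∷ within′ ← All-resp-↭ M↭ within
    = begin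
    length M                            ≡⟨ ↭-length M↭ ⟩
    suc (length M′)                     ≤⟨ s≤s (length≤best k _ _ le′ M′ inv′ below sep′) ⟩
    suc (best (toℕ u) (toℕ (π ⟨$⟩ˡ v))) ≤⟨ best-step u v inv₀ v≡x (position≡ (∈-resp-↭ M↭ f∈M)) ⟩
    best (suc x) (suc y)                ∎
    where
    open ≤-Reasoning
    not-above : ∀ {f} → Inversion f → Within (suc x) (suc y) f → ¬ (u , v) ≺ f
    not-above (a<b , _) (b≤x , _) (v<a , _) = <⇒≱ (<-trans v<a a<b) (≤-trans b≤x (≤-reflexive (sym v≡x)))
    position≡ : (u′ , v′) ∈ (u , v) ∷ M′ → position u ≡ suc y
    position≡ (here refl) = u′≡y
    -- Were the edge reaching position `suc y` another one, it would lie above `(u , v)`, exceeding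
    -- the value `suc x`, or below it, pushing `position u` past `suc y`.
    position≡ (there f∈) with All.lookup seps f∈
    ... | inj₁ e≺f = contradiction e≺f (not-above (All.lookup inv′ f∈) (All.lookup within′ f∈))
    ... | inj₂ (_ , pu′<pv) =
      contradiction u≤y (<⇒≱ (subst (_< position u) u′≡y (<-trans pu′<pv (proj₂ inv₀))))
    below : All (Within (toℕ u) (toℕ (π ⟨$⟩ˡ v))) M′
    below = All.tabulate λ f∈ → lower (All.lookup inv′ f∈) (All.lookup within′ f∈) (All.lookup seps f∈)
      where
      lower : ∀ {f} → Inversion f → Within (suc x) (suc y) f → Separated (u , v) f →
              Within (toℕ u) (toℕ (π ⟨$⟩ˡ v)) f
      lower inv w (inj₁ e≺f)     = contradiction e≺f (not-above inv w)
      lower inv w (inj₂ (a , b)) = s≤s⁻¹ a , s≤s⁻¹ b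
    le′ : toℕ u + toℕ (π ⟨$⟩ˡ v) ≤ k
    le′ = ≤-trans (+-mono-≤ (<⇒≤ (s≤s⁻¹ (≤-trans (proj₁ inv₀) v≤x)))
                            (≤-trans (<⇒≤ (<⇒≤ (proj₂ inv₀))) u≤y)) le

  matching≤best : ∀ M → IsInducedMatching E M → length M ≤ best n n
  matching≤best M matching = subst (_≤ best n n) (length-map orient M)
    (length≤best (n + n) n n ≤-refl (map orient M)
      (All.map⁺ inversions)
      (All.universal (λ (u , v) → toℕ<n v , toℕ<n (π ⟨$⟩ˡ u)) _)
      (AllPairs.map⁺ (AllPairs-map-∈ separated distinct)))
    where
    open IsInducedMatching matching
    inversions : All (Inversion ∘ orient) M
    inversions = All.map (λ {(u , v)} → orient-inversion u v) edges
    separated : ∀ {e f} → e ∈ M → f ∈ M → ¬ SameEdge e f → Separated (orient e) (orient f)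
    separated {e} {f} e∈ f∈ e≢f = independent⇒separated _ _
      (All.lookup inversions e∈) (All.lookup inversions f∈)
      (orient-independent e f (induced e∈ f∈ e≢f))

  -- Chains are induced matchings.

  record Chain (x y : ℕ) (M : List Edge) : Set where
    field
      inversions : All Inversion M
      -- The bounds are from below because the traceback finds edges from the top down and adds each
      -- one at the front.
      above      : All (λ (u , v) → x < label u × y < position v) M
      ordered    : AllPairs _≺_ M

  open Chain

  chain-[] : ∀ {x y} → Chain x y []
  chain-[] = record { inversions = [] ; above = [] ; ordered = [] }

  chain-weaken : ∀ {x y x′ y′ M} → x′ ≤ x → y′ ≤ y → Chain x y M → Chain x′ y′ M
  chain-weaken x′≤x y′≤y c = record
    { inversions = inversions c
    ; above      = All.map (λ (a , b) → ≤-<-trans x′≤x a , ≤-<-trans y′≤y b) (above c)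
    ; ordered    = ordered c
    }

  -- The new bounds are one less than the smaller value and the smaller position of the added edge,
  -- which is where the recurrence continues.
  chain-∷ : ∀ {x y u v M} → Inversion (u , v) → label v ≡ x → position u ≡ y →
            Chain x y M → Chain (toℕ u) (toℕ (π ⟨$⟩ˡ v)) ((u , v) ∷ M)
  chain-∷ (u<v , pv<pu) refl refl c = record
    { inversions = (u<v , pv<pu) ∷ inversions c
    ; above      = (≤-refl , ≤-refl) ∷
                   All.map (λ (a , b) → <-trans (<⇒≤ u<v) a , <-trans (<⇒≤ pv<pu) b) (above c)
    ; ordered    = above c ∷ ordered c
    }

  ≺⇒independent : ∀ {e f} → Inversion e → Inversion f → e ≺ f → Independent e f
  ≺⇒independent (u₁<v₁ , pv₁<pu₁) (u₂<v₂ , pv₂<pu₂) (v₁<u₂ , pu₁<pv₂) =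
    ⊏⇒¬edge (<-trans u₁<v₁ v₁<u₂ , <-trans pu₁<pv₂ pv₂<pu₂) ,
    ⊏⇒¬edge (<-trans u₁<v₁ (<-trans v₁<u₂ u₂<v₂) , pu₁<pv₂) ,
    ⊏⇒¬edge (v₁<u₂ , <-trans pv₁<pu₁ (<-trans pu₁<pv₂ pv₂<pu₂)) ,
    ⊏⇒¬edge (<-trans v₁<u₂ u₂<v₂ , <-trans pv₁<pu₁ pu₁<pv₂)

  independent-sym : ∀ e f → Independent e f → Independent f e
  independent-sym (u₁ , v₁) (u₂ , v₂) (a , b , c , d) =
    a ∘ edge-sym u₂ u₁ , c ∘ edge-sym u₂ v₁ , b ∘ edge-sym v₂ u₁ , d ∘ edge-sym v₂ v₁

  ordered-∈ : ∀ {M e f} → AllPairs _≺_ M → e ∈ M → f ∈ M → e ≡ f ⊎ Separated e f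
  ordered-∈ (_ ∷ _)  (here refl) (here refl) = inj₁ refl
  ordered-∈ (a ∷ _)  (here refl) (there f∈)  = inj₂ (inj₁ (All.lookup a f∈))
  ordered-∈ (a ∷ _)  (there e∈)  (here refl) = inj₂ (inj₂ (All.lookup a e∈))
  ordered-∈ (_ ∷ as) (there e∈)  (there f∈)  = ordered-∈ as e∈ f∈

  ≺⇒≢ : ∀ {e f} → Inversion e → Inversion f → e ≺ f → ¬ SameEdge e f
  ≺⇒≢ (u₁<v₁ , _) (u₂<v₂ , _) (v₁<u₂ , _) (inj₁ (refl , refl)) = <-asym u₁<v₁ v₁<u₂
  ≺⇒≢ _ _ (v₁<u₂ , _) (inj₂ (refl , refl)) = <-irrefl refl v₁<u₂

  chain⇒matching : ∀ {x y M} → Chain x y M → IsInducedMatching E M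
  chain⇒matching {M = M} c = record
    { edges    = All.map edge⁺ (inversions c)
    ; distinct = AllPairs-map-∈
        (λ e∈ f∈ → ≺⇒≢ (All.lookup (inversions c) e∈) (All.lookup (inversions c) f∈)) (ordered c)
    ; induced  = λ e∈ f∈ e≢f → independent e∈ f∈ e≢f (ordered-∈ (ordered c) e∈ f∈)
    }
    where
    independent : ∀ {e f} → e ∈ M → f ∈ M → ¬ SameEdge e f → e ≡ f ⊎ Separated e f → Independent e f
    independent _ _ e≢f (inj₁ refl) = contradiction (inj₁ (refl , refl)) e≢f
    independent e∈ f∈ _ (inj₂ (inj₁ e≺f)) =
      ≺⇒independent (All.lookup (inversions c) e∈) (All.lookup (inversions c) f∈) e≺f
    independent {e} {f} e∈ f∈ _ (inj₂ (inj₂ f≺e)) = independent-sym f e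
      (≺⇒independent (All.lookup (inversions c) f∈) (All.lookup (inversions c) e∈) f≺e)

  chain⇒maximum : ∀ {x y M} → Chain x y M → length M ≡ best n n → IsMaximumInducedMatching E M
  chain⇒maximum c length≡ = record
    { isInducedMatching = chain⇒matching c
    ; maximum = λ M′ m → subst (length M′ ≤_) (sym length≡) (matching≤best M′ m)
    }

-- The program.

-- With N = n + 1, cells 1 … n hold π, cells N + 1 … N + n its inverse, cell
-- 2N + x the address 3N + xN of row x of the table, and cell y of that row
-- the maximum for values ≤ x and positions ≤ y.  The output follows the
-- table.  Registers: 2 ↦ 1, 3 ↦ N, 4 ↦ 2N, 6 ↦ x, 7 and 8 ↦ rows x and
-- x − 1, 9 ↦ π⁻¹(x), 10 ↦ y, 11 ↦ the current maximum.  Numbers between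
-- the instructions are labels of jump targets.
program : Program
program =
    const 2 1
  ∷ add 3 0 2
  ∷ add 4 3 3
  ∷ add 7 4 3
  ∷ store 4 7
  ∷ const 6 1
  -- 6: invert π and fill in the row addresses
  ∷ jlt 0 6 15
  ∷ load 12 6
  ∷ add 12 12 3
  ∷ store 12 6
  ∷ add 7 7 3
  ∷ add 12 4 6
  ∷ store 12 7
  ∷ add 6 6 2
  ∷ jump 6
  ∷ add 7 4 3
  ∷ const 6 1
  -- 17: loop over x
  ∷ jlt 0 6 49
  ∷ copy 8 7
  ∷ add 7 7 3
  ∷ add 12 3 6
  ∷ load 9 12
  ∷ const 10 1
  ∷ const 11 0
  -- 24: loop over y; a maximum is computed as a + (b ∸ a)
  ∷ jlt 0 10 47
  ∷ add 12 8 10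
  ∷ load 12 12
  ∷ sub 12 12 11
  ∷ add 11 11 12
  ∷ load 12 10
  ∷ jlt 12 6 32
  ∷ jump 43
  ∷ jlt 9 10 34
  ∷ jump 43
  -- The candidate: register 12 holds `π(y)`, row `π(y) − 1` is found through its stored address,
  -- and the column is `π⁻¹(x) − 1`.
  ∷ sub 12 12 2
  ∷ add 12 4 12
  ∷ load 12 12
  ∷ sub 13 9 2
  ∷ add 12 12 13
  ∷ load 12 12
  ∷ add 12 12 2
  ∷ sub 12 12 11
  ∷ add 11 11 12
  -- 43
  ∷ add 12 7 10
  ∷ store 12 11
  ∷ add 10 10 2
  ∷ jump 24
  ∷ add 6 6 2
  ∷ jump 17
  -- 49: trace back from (n , n), writing the edges downwards
  ∷ copy 6 0
  ∷ copy 10 0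
  ∷ add 12 7 10
  ∷ load 11 12
  ∷ copy 5 11
  -- Register 1 starts just past the output array, two cells per edge after the table, and reaches
  -- its first cell when all edges are written.
  ∷ add 1 7 3
  ∷ add 1 1 11
  ∷ add 1 1 11
  -- 57
  ∷ jlt 11 2 85
  ∷ sub 8 7 3
  ∷ add 12 8 10
  ∷ load 12 12
  ∷ jlt 12 11 65
  ∷ copy 7 8
  ∷ sub 6 6 2
  ∷ jump 57
  -- 65
  ∷ sub 12 10 2
  ∷ add 13 7 12
  ∷ load 13 13
  ∷ jlt 13 11 71
  ∷ copy 10 12
  ∷ jump 57
  -- 71
  ∷ load 12 10
  ∷ add 13 3 6
  ∷ load 13 13
  ∷ sub 10 13 2
  ∷ sub 13 12 2
  ∷ add 7 4 13
  ∷ load 7 7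
  ∷ sub 1 1 2
  ∷ store 1 6
  ∷ sub 1 1 2
  ∷ store 1 12
  ∷ copy 6 13
  ∷ sub 11 11 2
  ∷ jump 57
  -- 85
  ∷ copy 0 5
  ∷ halt
  ∷ []

-- The running time.

traceback-time : ℕ → ℕ
-- The factors count the instructions on the longest path through a loop body: 23 here, 21 per table
-- entry, 9 per position when inverting `π`.
traceback-time k = k * 23 + 3

output-time : ℕ → ℕ
-- Each round of the traceback lowers `x + y`, which starts at `n + n`.
output-time n = 8 + traceback-time (n + n)

fill-time : ℕ → ℕ → ℕ
fill-time n k = k * (10 + n * 21) + suc (output-time n)

prepare-time : ℕ → ℕ → ℕ
prepare-time n k = k * 9 + suc (2 + fill-time n n)

running-time : ℕ → ℕ
running-time n = 6 + prepare-time n n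

running-time-quadratic : running-time ∈O (_^ 2)
-- The running time is `21 n² + 65 n + 21`, and 107 is the sum of the coefficients. For `n = m + 1`
-- the slack is `86 m² + 107 m`.
running-time-quadratic = 107 , 1 , bound
  where
  expand : ∀ m → let n = suc m in
           6 + (n * 9 + suc (2 + (n * (10 + n * 21) + suc (8 + ((n + n) * 23 + 3)))))
             + (86 * (m * m) + 107 * m)
           ≡ 107 * (n * (n * 1))
  expand = solve-∀
  bound : ∀ n → 1 ≤ n → running-time n ≤ 107 * n ^ 2
  bound (suc m) _ = ≤-trans (m≤m+n (running-time (suc m)) _) (≤-reflexive (expand m))

-- The output array.

data Stored {n} (μ : ℕ → ℕ) (a : ℕ) : List (Fin n × Fin n) → Set where
  []  : Stored μ a []
  _∷_ : ∀ {u v M} → μ a ≡ label u × μ (a + 1) ≡ label v → Stored μ (2 + a) M →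
        Stored μ a ((u , v) ∷ M)

stored-update : ∀ {n μ a b z} {M : List (Fin n × Fin n)} → b < a → Stored μ a M →
                Stored (μ [ b ≔ z ]) a M
stored-update b<a [] = []
stored-update {μ = μ} {z = z} b<a ((u≡ , v≡) ∷ s) =
  (trans (update-other μ z (>⇒≢ b<a)) u≡ ,
   trans (update-other μ z (>⇒≢ (<-≤-trans b<a (m≤m+n _ 1)))) v≡)
  ∷ stored-update (m≤n⇒m≤1+n (m≤n⇒m≤1+n b<a)) s

stored-first : ∀ {n μ a} {M : List (Fin n × Fin n)} → Stored μ a M →
               ∀ i → μ (a + 2 * toℕ i) ≡ label (proj₁ (lookup M i))
stored-first {μ = μ} {a} ((u≡ , _) ∷ s) zero    = trans (cong μ (+-identityʳ a)) u≡
stored-first {μ = μ} {a} (_ ∷ s)        (suc i) =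
  trans (cong μ (shift-index a (toℕ i))) (stored-first s i)
  where
  shift-index : ∀ a i → a + 2 * suc i ≡ 2 + a + 2 * i
  shift-index = solve-∀

stored-second : ∀ {n μ a} {M : List (Fin n × Fin n)} → Stored μ a M →
                ∀ i → μ (a + 2 * toℕ i + 1) ≡ label (proj₂ (lookup M i))
stored-second {μ = μ} {a} ((_ , v≡) ∷ s) zero    = trans (cong (λ b → μ (b + 1)) (+-identityʳ a)) v≡
stored-second {μ = μ} {a} (_ ∷ s)        (suc i) =
  trans (cong μ (shift-index a (toℕ i))) (stored-second s i)
  where
  shift-index : ∀ a i → a + 2 * suc i + 1 ≡ 2 + a + 2 * i + 1
  shift-index = solve-∀

m+[n∸m]≡m⊔n : ∀ m n → m + (n ∸ m) ≡ m ⊔ n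
m+[n∸m]≡m⊔n zero    n       = refl
m+[n∸m]≡m⊔n (suc m) zero    = cong suc (+-identityʳ m)
m+[n∸m]≡m⊔n (suc m) (suc n) = cong suc (m+[n∸m]≡m⊔n m n)

-- Memory layout and word size.

module Correctness {n} (π : Permutation′ n) where

  open Combinatorics π

  N W : ℕ
  N = suc n
  W = wordBound 3 n

  row : ℕ → ℕ
  row zero    = N + N + N
  row (suc x) = row x + N

  row≡ : ∀ x → row x ≡ (3 + x) * N
  row≡ zero    = three n
    where
    three : ∀ n → suc n + suc n + suc n ≡ 3 * suc n
    three = solve-∀
  row≡ (suc x) = trans (cong (_+ N) (row≡ x)) (+-comm _ N)

  row-mono : ∀ {x x′} → x ≤ x′ → row x ≤ row x′
  row-mono {x} {x′} x≤x′ = subst₂ _≤_ (sym (row≡ x)) (sym (row≡ x′)) (*-monoˡ-≤ N (+-monoʳ-≤ 3 x≤x′))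

  row-end : ∀ {x x′ y} → y ≤ n → x < x′ → row x + y < row x′
  row-end {x} y≤n x<x′ = <-≤-trans (+-monoʳ-< (row x) (s≤s y≤n)) (row-mono x<x′)

  -- Columns go up to `n` and rows are `N` cells apart, so a smaller row ends before the next one
  -- starts.
  row-injective : ∀ {x x′ y y′} → y ≤ n → y′ ≤ n → row x + y ≡ row x′ + y′ → x ≡ x′ × y ≡ y′
  row-injective {x} {x′} y≤n y′≤n eq with <-cmp x x′
  ... | tri< x<x′ _ _ = contradiction eq (<⇒≢ (<-≤-trans (row-end y≤n x<x′) (m≤m+n _ _)))
  ... | tri> _ _ x′<x = contradiction eq (>⇒≢ (<-≤-trans (row-end y′≤n x′<x) (m≤m+n _ _)))
  ... | tri≈ _ refl _ = refl , +-cancelˡ-≡ (row x) _ _ eq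

  -- Covers the table and the output, which reaches at most `2 n` cells past `row N`. The polynomial
  -- added in the proof is the exact difference from `W`, the fourth power of `2 + n`.
  word-table : ∀ {x y} → x ≤ N → y ≤ n + n → row x + y < W
  word-table {x} {y} x≤N y≤2n = begin-strict
    row x + y                         ≤⟨ +-mono-≤ (row-mono x≤N) y≤2n ⟩
    row N + (n + n)                   ≡⟨ cong (_+ (n + n)) (row≡ N) ⟩
    (3 + N) * N + (n + n)             <⟨ m<m+n _ (s≤s z≤n) ⟩
    (3 + N) * N + (n + n) + suc (n * n * n * n + 8 * (n * n * n) + 23 * (n * n) + 25 * n + 11)
                                      ≡⟨ expand n ⟩
    W                                 ∎
    where
    open ≤-Reasoning
    expand : ∀ n → (3 + suc n) * suc n + (n + n) +
             suc (n * n * n * n + 8 * (n * n * n) + 23 * (n * n) + 25 * n + 11)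
             ≡ (2 + n) * ((2 + n) * ((2 + n) * ((2 + n) * 1)))
    expand = solve-∀

  word-low : ∀ {z} → z ≤ row 0 → z < W
  word-low z≤ = ≤-<-trans z≤ (subst (_< W) (+-identityʳ (row 0)) (word-table z≤n z≤n))

  word-row : ∀ {x} → x ≤ N → row x < W
  word-row {x} x≤N = subst (_< W) (+-identityʳ (row x)) (word-table x≤N z≤n)

  word-≤N : ∀ {z} → z ≤ N → z < W
  word-≤N z≤N = word-low (≤-trans z≤N (m≤n+m N (N + N)))

  word-N+ : ∀ {v} → v ≤ N → N + v < W
  word-N+ v≤N = word-low (≤-trans (+-monoʳ-≤ N v≤N) (m≤m+n (N + N) N))

  word-2N+ : ∀ {x} → x ≤ N → N + N + x < W
  word-2N+ x≤N = word-low (+-monoʳ-≤ (N + N) x≤N)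

  -- The address `b` is the frontier of the row-by-row filling: entries below it are final, and
  -- `b = row N` means a complete table.
  record Tables (μ : ℕ → ℕ) (b : ℕ) : Set where
    field
      input   : ∀ {i} → i ≤ n → μ i ≡ p i
      inverse : ∀ {v} → v ≤ n → μ (N + v) ≡ q v
      rows    : ∀ {x} → x ≤ n → μ (N + N + x) ≡ row x
      table   : ∀ x {y} → y ≤ n → row x + y < b → μ (row x + y) ≡ best x y

  open Tables

  -- Row 0 and column 0 of the table are never written; they are right because `best` vanishes there
  -- and memory past the frontier is still 0.
  Zero : (ℕ → ℕ) → ℕ → Set
  Zero μ b = ∀ {a} → b ≤ a → μ a ≡ 0

  input-low : ∀ {i} → i ≤ n → i < row 0
  input-low i≤n = ≤-trans (s≤s i≤n) (m≤n+m N (N + N))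

  inverse-low : ∀ {v} → v ≤ n → N + v < row 0
  inverse-low {v} v≤n = <-≤-trans (+-monoʳ-< N (s≤s v≤n)) (m≤m+n (N + N) N)

  rows-low : ∀ {x} → x ≤ n → N + N + x < row 0
  rows-low x≤n = +-monoʳ-< (N + N) (s≤s x≤n)

  tables-update : ∀ {μ a b z} → row 0 ≤ a → b ≤ a → Tables μ b → Tables (μ [ a ≔ z ]) b
  tables-update {μ} {a} {b} {z} low b≤a t = record
    { input   = λ i≤n → trans (keep (<-≤-trans (input-low i≤n) low)) (input t i≤n)
    ; inverse = λ v≤n → trans (keep (<-≤-trans (inverse-low v≤n) low)) (inverse t v≤n)
    ; rows    = λ x≤n → trans (keep (<-≤-trans (rows-low x≤n) low)) (rows t x≤n)
    ; table   = λ x y≤n <b → trans (keep (<-≤-trans <b b≤a)) (table t x y≤n <b)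
    }
    where
    keep : ∀ {c} → c < a → (μ [ a ≔ z ]) c ≡ μ c
    keep c<a = update-other μ z (<⇒≢ c<a)

  tables-extend : ∀ {μ x y} → y ≤ n → μ (row x + y) ≡ best x y →
                  Tables μ (row x + y) → Tables μ (row x + suc y)
  tables-extend {μ} {x} {y} y≤n new t = record
    { input = input t ; inverse = inverse t ; rows = rows t ; table = extended }
    where
    extended : ∀ x′ {y′} → y′ ≤ n → row x′ + y′ < row x + suc y → μ (row x′ + y′) ≡ best x′ y′
    extended x′ {y′} y′≤n lt with row x′ + y′ ≟ row x + y
    ... | no ≢ = table t x′ y′≤n (≤∧≢⇒< (s≤s⁻¹ (subst (row x′ + y′ <_) (+-suc (row x) y) lt)) ≢)
    ... | yes eq with refl , refl ← row-injective {x′} {x} y′≤n y≤n eq = new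

  zero-update : ∀ {μ x y z} → Zero μ (row x + y) → Zero (μ [ row x + y ≔ z ]) (row x + suc y)
  zero-update {μ} {x} {y} {z} zeros {a} ≤a = trans (update-other μ z (>⇒≢ lt)) (zeros (<⇒≤ lt))
    where
    lt : row x + y < a
    lt = subst (_≤ a) (+-suc (row x) y) ≤a

  -- Verification of the traceback.

  Correct : Configuration → Set
  Correct d = Σ[ M ∈ List Edge ] Outputs d M × IsMaximumInducedMatching E M

  open Verification program W Correct

  regs : ℕ → ℕ → ℕ → ℕ → ℕ → ℕ → ℕ → ℕ → ℕ → ℕ → List ℕ
  regs r₁ r₅ r₆ r₇ r₈ r₉ r₁₀ r₁₁ r₁₂ r₁₃ =
    n ∷ r₁ ∷ 1 ∷ N ∷ N + N ∷ r₅ ∷ r₆ ∷ r₇ ∷ r₈ ∷ r₉ ∷ r₁₀ ∷ r₁₁ ∷ r₁₂ ∷ r₁₃ ∷ []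

  finish : ∀ {x y M b μ r₆ r₇ r₈ r₉ r₁₀ r₁₂ r₁₃} → Chain x y M → length M + b ≡ best n n →
           Stored μ (row N + b + b) M → b < 1 →
           Terminates 2 85 (regs (row N + b + b) (best n n) r₆ r₇ r₈ r₉ r₁₀ b r₁₂ r₁₃) μ
  finish {M = M} {zero} {μ} chain length≡ stored _ = run (run λ ρ ρ≗ → M , record
    { size   = trans (ρ≗ 0) (sym length≡′)
    ; first  = λ i → trans (cong (λ a → μ (a + 2 * toℕ i)) (ρ≗ 1)) (stored-first stored i)
    ; second = λ i → trans (cong (λ a → μ (a + 2 * toℕ i + 1)) (ρ≗ 1)) (stored-second stored i)
    } , chain⇒maximum chain length≡′)
    where
    length≡′ : length M ≡ best n n
    length≡′ = trans (sym (+-identityʳ (length M))) length≡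
  finish {b = suc _} _ _ _ (s≤s ())

  -- The witnesses are the vertex in position `suc y` and the vertex of value `suc x`; the guards of
  -- the candidate say that they form an inversion.
  attained-edge : ∀ {x y} → x < n → y < n → p (suc y) < suc x → q (suc x) < suc y →
                  ∃[ u ] ∃[ v ] Inversion (u , v) × label v ≡ suc x × position u ≡ suc y ×
                    label u ≡ p (suc y) × position v ≡ q (suc x)
  attained-edge {x} {y} x<n y<n p<x q<y =
    u , v , (subst₂ _<_ (sym u≡) (sym v≡) p<x , subst₂ _<_ (sym pv≡) (sym pu≡) q<y) ,
    v≡ , pu≡ , u≡ , pv≡
    where
    u v : Fin n
    u = π ⟨$⟩ʳ fromℕ< y<n
    v = fromℕ< x<n
    v≡ : label v ≡ suc x
    v≡ = label-fromℕ< x<n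
    pu≡ : position u ≡ suc y
    pu≡ = trans (cong label (inverseˡ π)) (label-fromℕ< y<n)
    u≡ : label u ≡ p (suc y)
    u≡ = trans (sym (p-position u)) (cong p pu≡)
    pv≡ : position v ≡ q (suc x)
    pv≡ = trans (sym (q-label v)) (cong q v≡)

  -- Invariant: `M` is the part of the chain already written, `b` edges remain to be found below it,
  -- and register 1 leaves two cells for each of them.
  traceback : ∀ k x y {M b μ r₈ r₉ r₁₂ r₁₃} → x + y ≤ k → x ≤ n → y ≤ n → Tables μ (row N) →
              Chain x y M → b ≡ best x y → length M + b ≡ best n n → Stored μ (row N + b + b) M →
              Terminates (traceback-time k) 57
                (regs (row N + b + b) (best n n) x (row x) r₈ r₉ y b r₁₂ r₁₃) μ
  traceback k zero y le x≤n y≤n t chain b≡ length≡ stored =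
    relax (m≤n+m 3 (k * 23)) (run ((λ b<1 → finish chain length≡ stored b<1) ,
      λ 1≤b → contradiction (trans b≡ (best-zeroˡ y)) (>⇒≢ 1≤b)))
  traceback k (suc x) zero le x≤n y≤n t chain b≡ length≡ stored =
    relax (m≤n+m 3 (k * 23)) (run ((λ b<1 → finish chain length≡ stored b<1) ,
      λ 1≤b → contradiction (trans b≡ (best-zeroʳ (suc x))) (>⇒≢ 1≤b)))
  traceback (suc k) (suc x) (suc y) {M} {b} {μ} {r₉ = r₉} (s≤s le) x<n y<n t chain b≡ length≡ stored =
    run ((λ b<1 → relax (s≤s (s≤s z≤n)) (finish chain length≡ stored b<1)) , λ _ →
    run (row x , m+n∸n≡m (row x) N ,
    run (_ , refl , word-table (<⇒≤ x<N) y≤2n ,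
    run (best x (suc y) , table t x y<n (row-end y<n x<N) ,
    run (descend , λ ge →
    -- By monotonicity `ge` makes the entry of row `x` equal to `b`. This path takes 8 instructions,
    -- and 15 pad it to the 23 of the longest.
    run (run (x , refl , run (relax (m≤n+m _ 15)
      (traceback k x (suc y) le (<⇒≤ x<n) y<n t (chain-weaken (n≤1+n x) ≤-refl chain)
        (≤-antisym ge (subst (best x (suc y) ≤_) (sym b≡) (best-suc-≥ˡ x y)))
        length≡ stored)))))))))
    where
    x<N : x < N
    x<N = m≤n⇒m≤1+n x<n
    y≤2n : suc y ≤ n + n
    y≤2n = ≤-trans y<n (m≤m+n n n)
    p≤n : p (suc y) ≤ n
    p≤n = inputMemory≤ π (suc y)

    emit : ∀ {b′ u v r₈ r₁₂ r₁₃} → b ≡ suc b′ →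
           b′ ≡ best (p (suc y) ∸ 1) (q (suc x) ∸ 1) →
           Inversion (u , v) → label v ≡ suc x → position u ≡ suc y →
           label u ≡ p (suc y) → position v ≡ q (suc x) →
           Terminates (14 + traceback-time k) 71
             (regs (row N + b + b) (best n n) (suc x) (row (suc x)) r₈ r₉ (suc y) b r₁₂ r₁₃) μ
    emit {b′} {u} {v} refl b′≡ inv v≡ pu≡ u≡ pv≡ =
      run (p (suc y) , input t y<n ,
      run (_ , refl , word-N+ x<N ,
      run (q (suc x) , inverse t x<n ,
      run (_ , refl ,
      run (_ , refl ,
      run (_ , refl , word-2N+ (≤-trans (m∸n≤m _ 1) (m≤n⇒m≤1+n p≤n)) ,
      run (row (p (suc y) ∸ 1) , rows t (≤-trans (m∸n≤m _ 1) p≤n) ,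
      -- Two decrements take register 1 to `a`, its value for the `b′` remaining edges; the end of
      -- larger value is written first, at `a + 1`.
      run (a + 1 , trans (cong (_∸ 1) (pointer (row N) b′)) (m+n∸n≡m (a + 1) 1) ,
      run (run (a , m+n∸n≡m a 1 ,
      run (run (run (_ , refl ,
      run (traceback k (p (suc y) ∸ 1) (q (suc x) ∸ 1) le′
        (≤-trans (m∸n≤m _ 1) p≤n) (≤-trans (m∸n≤m _ 1) (inputMemory≤ (flip π) (suc x)))
        tables′ chain′ b′≡ (trans (sym (+-suc (length M) b′)) length≡) stored′))))))))))))))
      where
      a : ℕ
      a = row N + b′ + b′
      pointer : ∀ r b → r + suc b + suc b ≡ r + b + b + 1 + 1
      pointer = solve-∀
      row≤a : row N ≤ a
      row≤a = ≤-trans (m≤m+n (row N) b′) (m≤m+n _ b′)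
      row0≤a : row 0 ≤ a
      row0≤a = ≤-trans (row-mono {0} {N} z≤n) row≤a
      u∸1 : toℕ u ≡ p (suc y) ∸ 1
      u∸1 = cong (_∸ 1) u≡
      v∸1 : toℕ (π ⟨$⟩ˡ v) ≡ q (suc x) ∸ 1
      v∸1 = cong (_∸ 1) pv≡
      le′ : p (suc y) ∸ 1 + (q (suc x) ∸ 1) ≤ k
      le′ = subst₂ (λ c d → c + d ≤ k) u∸1 v∸1
        (≤-trans (+-mono-≤ (<⇒≤ (s≤s⁻¹ (subst (label u <_) v≡ (proj₁ inv))))
                           (<⇒≤ (<⇒≤ (subst (position v <_) pu≡ (proj₂ inv))))) le)
      tables′ : Tables (μ [ a + 1 ≔ suc x ] [ a ≔ p (suc y) ]) (row N)
      tables′ = tables-update row0≤a row≤a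
        (tables-update (≤-trans row0≤a (m≤m+n a 1)) (≤-trans row≤a (m≤m+n a 1)) t)
      chain′ : Chain (p (suc y) ∸ 1) (q (suc x) ∸ 1) ((u , v) ∷ M)
      chain′ = subst₂ (λ c d → Chain c d ((u , v) ∷ M)) u∸1 v∸1 (chain-∷ inv v≡ pu≡ chain)
      stored′ : Stored (μ [ a + 1 ≔ suc x ] [ a ≔ p (suc y) ]) a ((u , v) ∷ M)
      stored′ =
        (trans (update-same μ₁ a _) (sym u≡) ,
         trans (update-other μ₁ _ (>⇒≢ (m<m+n a (s≤s z≤n)))) (trans (update-same μ (a + 1) _) (sym v≡)))
        ∷ stored-update (s≤s (n≤1+n a)) (stored-update (subst (_< 2 + a) (+-comm 1 a) ≤-refl)
            (subst (λ c → Stored μ c M) (trans (pointer (row N) b′) (+-comm-2 a)) stored))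
        where
        μ₁ : ℕ → ℕ
        μ₁ = μ [ a + 1 ≔ suc x ]
        +-comm-2 : ∀ a → a + 1 + 1 ≡ 2 + a
        +-comm-2 = solve-∀

    descend : ∀ {r₈ r₁₂ r₁₃} → best x (suc y) < b →
              Terminates (18 + traceback-time k) 65
                (regs (row N + b + b) (best n n) (suc x) (row (suc x)) r₈ r₉ (suc y) b r₁₂ r₁₃) μ
    descend lt =
      run (y , refl ,
      run (_ , refl , word-table x<N (≤-trans (n≤1+n y) y≤2n) ,
      run (best (suc x) y , table t (suc x) (<⇒≤ y<n) (row-end (<⇒≤ y<n) (s≤s x<n)) ,
      run (top , λ ge →
      run (run (relax (m≤n+m _ 12) (traceback k (suc x) y (subst (_≤ k) (+-suc x y) le) x<n (<⇒≤ y<n) t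
        (chain-weaken ≤-refl (n≤1+n y) chain)
        (≤-antisym ge (subst (best (suc x) y ≤_) (sym b≡) (best-suc-≥ʳ x y)))
        length≡ stored)))))))
      where
      top : ∀ {r₈ r₁₂ r₁₃} → best (suc x) y < b →
            Terminates (14 + traceback-time k) 71
              (regs (row N + b + b) (best n n) (suc x) (row (suc x)) r₈ r₉ (suc y) b r₁₂ r₁₃) μ
      top lt′
        with p<x , q<y , eq ← best-attained x y (subst (best (suc x) y <_) b≡ lt′)
                                                (subst (best x (suc y) <_) b≡ lt)
        with u , v , inv , v≡ , pu≡ , u≡ , pv≡ ← attained-edge x<n y<n p<x q<y =
        emit (trans b≡ eq) refl inv v≡ pu≡ u≡ pv≡

  start-traceback : ∀ {μ r₁ r₅ r₆ r₈ r₉ r₁₀ r₁₁ r₁₂ r₁₃} → Tables μ (row N) →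
                    Terminates (output-time n) 49 (regs r₁ r₅ r₆ (row n) r₈ r₉ r₁₀ r₁₁ r₁₂ r₁₃) μ
  start-traceback t =
    run (run (run (_ , refl , word-table (n≤1+n n) (m≤m+n n n) ,
    run (best n n , table t n ≤-refl (row-end {n} ≤-refl ≤-refl) ,
    run (run (_ , refl , word-row ≤-refl ,
    run (_ , refl , word-table ≤-refl (≤-trans (best≤ n n) (m≤m+n n n)) ,
    run (_ , refl ,
      subst (_< W) (sym (+-assoc (row N) _ _)) (word-table ≤-refl (+-mono-≤ (best≤ n n) (best≤ n n))) ,
      traceback (n + n) n n ≤-refl ≤-refl ≤-refl t chain-[] refl refl []))))))))

  -- Verification of the table filling.

  fill-row : ∀ {T} k x y {b μ r₁ r₅ r₁₂ r₁₃} → x < n → y + k ≡ n → b ≡ best (suc x) y →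
             Tables μ (row (suc x) + suc y) → Zero μ (row (suc x) + suc y) →
             -- The rest of the run enters as a continuation, valid for whatever the loop leaves in
             -- registers 10 to 13, and its time `T` is added to that of the loop.
             (∀ {μ r₁₀ r₁₁ r₁₂ r₁₃} → Tables μ (row (2 + x)) → Zero μ (row (2 + x)) →
               Terminates T 47 (regs r₁ r₅ (suc x) (row (suc x)) (row x) (q (suc x)) r₁₀ r₁₁ r₁₂ r₁₃) μ) →
             Terminates (k * 21 + suc T) 24
               (regs r₁ r₅ (suc x) (row (suc x)) (row x) (q (suc x)) (suc y) b r₁₂ r₁₃) μ
  fill-row zero x y {μ = μ} x<n y≡n _ t zeros continue =
    run ((λ _ → continue (subst (λ y → Tables μ (row (suc x) + suc y)) y≡n′ t)
                         (subst (λ y → Zero μ (row (suc x) + suc y)) y≡n′ zeros)) ,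
         λ y<n → contradiction y≡n′ (<⇒≢ y<n))
    where
    y≡n′ : y ≡ n
    y≡n′ = trans (sym (+-identityʳ y)) y≡n
  fill-row {T} (suc k) x y {μ = μ} {r₁} {r₅} x<n y+k≡n refl t zeros continue =
    run ((λ n<y → contradiction y<n (<⇒≱ n<y)) , λ _ →
    run (_ , refl , word-table (<⇒≤ x<N) (≤-trans y<n (m≤m+n n n)) ,
    run (best x (suc y) , table t x y<n (<-≤-trans (row-end {x} y<n ≤-refl) (m≤m+n _ (suc y))) ,
    run (_ , refl ,
    run (m , m+[n∸m]≡m⊔n (best (suc x) y) (best x (suc y)) ,
      word-≤N (≤-trans (⊔-lub (best≤ (suc x) y) (m≤n⇒m≤1+n (best≤ x (suc y)))) x<N) ,
    run (p (suc y) , input t y<n ,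
    -- When a guard fails, the candidate is 0 and the maximum `m` stands; these paths are 8 and 9
    -- instructions shorter than the one with the candidate.
    run ((λ p<x → run (include p<x , λ y≤q → run (relax (m≤n+m _ 8) (write (skip (candidate-noʳ y≤q)))))) ,
         λ x≤p → run (relax (m≤n+m _ 9) (write (skip (candidate-noˡ x≤p)))))))))))
    where
    m : ℕ
    m = best (suc x) y ⊔ best x (suc y)
    y<n : suc y ≤ n
    y<n = subst (suc y ≤_) (trans (sym (+-suc y k)) y+k≡n) (s≤s (m≤m+n y k))
    x<N : x < N
    x<N = m≤n⇒m≤1+n x<n
    write : ∀ {z r₁₂ r₁₃} → z ≡ best (suc x) (suc y) →
            Terminates (4 + (k * 21 + suc T)) 43
              (regs r₁ r₅ (suc x) (row (suc x)) (row x) (q (suc x)) (suc y) z r₁₂ r₁₃) μ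
    write refl =
      run (_ , refl , word-table x<N (≤-trans y<n (m≤m+n n n)) ,
      run (run (_ , +-comm _ 1 , word-≤N (s≤s y<n) ,
      run (fill-row k x (suc y) x<n (trans (sym (+-suc y k)) y+k≡n) refl
        (tables-extend {x = suc x} y<n (update-same μ (row (suc x) + suc y) _)
          (tables-update (≤-trans (row-mono {0} {suc x} z≤n) (m≤m+n _ _)) ≤-refl t))
        (zero-update {μ} {suc x} zeros) continue))))
    skip : candidate best (suc x) (suc y) ≡ 0 → m ≡ best (suc x) (suc y)
    skip none = sym (trans (best-suc x y) (trans (cong (m ⊔_) none) (⊔-identityʳ m)))
    include : ∀ {r₁₃} → p (suc y) < suc x → q (suc x) < suc y →
              Terminates (9 + (4 + (k * 21 + suc T))) 34
                (regs r₁ r₅ (suc x) (row (suc x)) (row x) (q (suc x)) (suc y) m (p (suc y)) r₁₃) μ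
    include p<x q<y =
      run (_ , refl ,
      run (_ , refl , word-2N+ (≤-trans p∸1≤x (<⇒≤ x<N)) ,
      run (row (p (suc y) ∸ 1) , rows t (≤-trans p∸1≤x (<⇒≤ x<n)) ,
      run (_ , refl ,
      run (_ , refl , word-table (≤-trans p∸1≤x (<⇒≤ x<N)) (≤-trans q∸1≤n (m≤m+n n n)) ,
      run (best (p (suc y) ∸ 1) (q (suc x) ∸ 1) ,
        table t (p (suc y) ∸ 1) q∸1≤n (<-≤-trans (row-end q∸1≤n (s≤s p∸1≤x)) (m≤m+n _ (suc y))) ,
      run (_ , +-comm _ 1 , word-≤N (s≤s (≤-trans (best≤ _ (q (suc x) ∸ 1)) (≤-trans p∸1≤x (<⇒≤ x<n)))) ,
      run (_ , refl ,
      run (best (suc x) (suc y) ,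
        trans (m+[n∸m]≡m⊔n m _) (trans (cong (m ⊔_) (sym (candidate-yes p<x q<y))) (sym (best-suc x y))) ,
        word-≤N (≤-trans (best≤ (suc x) (suc y)) x<N) ,
      write refl)))))))))
      where
      p∸1≤x : p (suc y) ∸ 1 ≤ x
      p∸1≤x = ≤-trans (m∸n≤m _ 1) (s≤s⁻¹ p<x)
      q∸1≤n : q (suc x) ∸ 1 ≤ n
      q∸1≤n = ≤-trans (m∸n≤m _ 1) (inputMemory≤ (flip π) (suc x))

  fill : ∀ k x {μ r₁ r₅ r₈ r₉ r₁₀ r₁₁ r₁₂ r₁₃} → x + k ≡ n →
         Tables μ (row (suc x)) → Zero μ (row (suc x)) →
         Terminates (fill-time n k) 17
           (regs r₁ r₅ (suc x) (row x) r₈ r₉ r₁₀ r₁₁ r₁₂ r₁₃) μ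
  fill zero x x≡n t zeros with refl ← trans (sym (+-identityʳ x)) x≡n =
    run ((λ _ → start-traceback t) , λ x<n → contradiction x<n (<-irrefl refl))
  fill (suc k) x {μ} x+k≡n t zeros = relax (≤-reflexive (cost k n (output-time n)))
    (run ((λ n<x → contradiction x<n (<⇒≱ n<x)) , λ _ →
    run (run (_ , refl , word-row (m≤n⇒m≤1+n x<n) ,
    run (_ , refl , word-N+ (m≤n⇒m≤1+n x<n) ,
    run (q (suc x) , inverse t x<n ,
    run (word-≤N (s≤s z≤n) ,
    run (word-≤N z≤n ,
    fill-row n x 0 x<n refl (sym (best-zeroʳ (suc x)))
      -- Column 0 of the new row is correct without a write, so the inner loop starts at column 1.
      (tables-extend {x = suc x} z≤n
        (trans (zeros (m≤m+n _ 0)) (sym (best-zeroʳ (suc x))))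
        (subst (Tables μ) (sym (+-identityʳ (row (suc x)))) t))
      (λ ≤a → zeros (≤-trans (m≤m+n _ 1) ≤a))
      λ t′ zeros′ →
        run (_ , +-comm _ 1 , word-≤N (s≤s x<n) ,
        run (fill k (suc x) (trans (sym (+-suc x k)) x+k≡n) t′ zeros′))))))))))
    where
    x<n : x < n
    x<n = subst (suc x ≤_) (trans (sym (+-suc x k)) x+k≡n) (s≤s (m≤m+n x k))
    cost : ∀ k n T → 7 + (n * 21 + suc (2 + (k * (10 + n * 21) + suc T))) ≡
                     (10 + n * 21) + k * (10 + n * 21) + suc T
    cost = solve-∀

  -- Inverting the permutation and storing the row addresses.

  record Prepared (μ : ℕ → ℕ) (x : ℕ) : Set where
    field
      input   : ∀ {i} → i ≤ n → μ i ≡ p i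
      -- After `x` rounds the values in positions up to `x` have been entered; the index 0, where
      -- `q` is 0, is covered from the start.
      inverse : ∀ {v} → v ≤ n → q v ≤ x → μ (N + v) ≡ q v
      rows    : ∀ {x′} → x′ ≤ x → μ (N + N + x′) ≡ row x′
      zeros   : Zero μ (row 0)

  prepared⇒tables : ∀ {μ} → Prepared μ n → Tables μ (row 1)
  prepared⇒tables {μ} s = record
    { input   = S.input
    ; inverse = λ {v} v≤n → S.inverse v≤n (inputMemory≤ (flip π) v)
    ; rows    = S.rows
    ; table   = first-row
    }
    where
    module S = Prepared s
    first-row : ∀ x {y} → y ≤ n → row x + y < row 1 → μ (row x + y) ≡ best x y
    first-row zero    {y} _ _ = trans (S.zeros (m≤m+n _ y)) (sym (best-zeroˡ y))
    first-row (suc x) {y} _ lt =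
      contradiction (≤-trans (row-mono {1} {suc x} (s≤s z≤n)) (m≤m+n _ y)) (<⇒≱ lt)

  -- Only `p (suc x)` has position `suc x`, so any other value in range was entered before. The two
  -- writes fall into disjoint blocks of memory.
  prepared-step : ∀ {μ x} → x < n → Prepared μ x →
                  Prepared (μ [ N + p (suc x) ≔ suc x ] [ N + N + suc x ≔ row (suc x) ]) (suc x)
  prepared-step {μ} {x} x<n s = record
    { input   = λ i≤n → trans (other₂ (<⇒≢ (<-≤-trans (s≤s i≤n) (≤-trans (m≤m+n N N) (m≤m+n _ _)))))
                       (trans (other₁ (<⇒≢ (<-≤-trans (s≤s i≤n) (m≤m+n _ _)))) (S.input i≤n))
    ; inverse = inverse′
    ; rows    = rows′
    ; zeros   = λ ≤a → trans (other₂ (>⇒≢ (<-≤-trans (rows-low x<n) ≤a)))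
                      (trans (other₁ (>⇒≢ (<-≤-trans (inverse-low (inputMemory≤ π (suc x))) ≤a)))
                        (S.zeros ≤a))
    }
    where
    module S = Prepared s
    μ₁ μ₂ : ℕ → ℕ
    μ₁ = μ [ N + p (suc x) ≔ suc x ]
    μ₂ = μ₁ [ N + N + suc x ≔ row (suc x) ]
    other₁ : ∀ {a} → a ≢ N + p (suc x) → μ₁ a ≡ μ a
    other₁ = update-other μ (suc x)
    other₂ : ∀ {a} → a ≢ N + N + suc x → μ₂ a ≡ μ₁ a
    other₂ = update-other μ₁ (row (suc x))
    inverse′ : ∀ {v} → v ≤ n → q v ≤ suc x → μ₂ (N + v) ≡ q v
    inverse′ {v} v≤n qv≤ = trans
      (other₂ (<⇒≢ (<-≤-trans (+-monoʳ-< N (s≤s v≤n)) (m≤m+n _ (suc x))))) entry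
      where
      entry : μ₁ (N + v) ≡ q v
      entry with v ≟ p (suc x)
      ... | yes refl = trans (update-same μ (N + p (suc x)) (suc x)) (sym (inputMemory-inverse π x<n))
      ... | no v≢p = trans (other₁ (v≢p ∘ +-cancelˡ-≡ N _ _))
        (S.inverse v≤n (s≤s⁻¹ (≤∧≢⇒< qv≤ λ qv≡ →
          v≢p (trans (sym (inputMemory-inverse (flip π) v≤n)) (cong p qv≡)))))
    rows′ : ∀ {x′} → x′ ≤ suc x → μ₂ (N + N + x′) ≡ row x′
    rows′ {x′} x′≤ with x′ ≟ suc x
    ... | yes refl = update-same μ₁ (N + N + suc x) _
    ... | no x′≢ = trans (other₂ (x′≢ ∘ +-cancelˡ-≡ (N + N) _ _))
      (trans (other₁ (>⇒≢ (<-≤-trans (+-monoʳ-< N (s≤s (inputMemory≤ π (suc x)))) (m≤m+n _ x′))))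
        (S.rows (s≤s⁻¹ (≤∧≢⇒< x′≤ x′≢))))

  prepare : ∀ k x {μ r₁ r₅ r₈ r₉ r₁₀ r₁₁ r₁₂ r₁₃} → x + k ≡ n → Prepared μ x →
            Terminates (prepare-time n k) 6
              (regs r₁ r₅ (suc x) (row x) r₈ r₉ r₁₀ r₁₁ r₁₂ r₁₃) μ
  prepare zero x x≡n s with refl ← trans (sym (+-identityʳ x)) x≡n =
    run ((λ _ →
      run (_ , refl , word-low ≤-refl ,
      run (word-≤N (s≤s z≤n) ,
      fill n 0 refl (prepared⇒tables s) (λ ≤a → Prepared.zeros s (≤-trans (m≤m+n (row 0) N) ≤a))))) ,
      λ x<n → contradiction x<n (<-irrefl refl))
  prepare (suc k) x {μ} x+k≡n s =
    run ((λ n<x → contradiction x<n (<⇒≱ n<x)) , λ _ →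
    run (p (suc x) , Prepared.input s x<n ,
    run (_ , +-comm _ N , word-N+ (m≤n⇒m≤1+n (inputMemory≤ π (suc x))) ,
    run (run (_ , refl , word-row (m≤n⇒m≤1+n x<n) ,
    run (_ , refl , word-2N+ (m≤n⇒m≤1+n x<n) ,
    run (run (_ , +-comm _ 1 , word-≤N (s≤s x<n) ,
    run (prepare k (suc x) (trans (sym (+-suc x k)) x+k≡n) (prepared-step x<n s))))))))))
    where
    x<n : x < n
    x<n = subst (suc x ≤_) (trans (sym (+-suc x k)) x+k≡n) (s≤s (m≤m+n x k))

  prepared-initially : Prepared (p [ N + N ≔ row 0 ]) 0
  prepared-initially = record
    { input   = λ i≤n → other (<⇒≢ (<-≤-trans (s≤s i≤n) (m≤m+n N N)))
    ; inverse = λ {v} v≤n qv≤0 → trans (other (<⇒≢ (+-monoʳ-< N (s≤s v≤n))))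
                  (trans (inputMemory-beyond π (m≤m+n N v)) (sym (n≤0⇒n≡0 qv≤0)))
    ; rows    = λ { z≤n → trans (cong (p [ N + N ≔ row 0 ]) (+-identityʳ (N + N)))
                                (update-same p (N + N) (row 0)) }
    ; zeros   = λ ≤a → trans (other (>⇒≢ (<-≤-trans (m<m+n (N + N) (s≤s z≤n)) ≤a)))
                  (inputMemory-beyond π (≤-trans (m≤n+m N (N + N)) ≤a))
    }
    where
    other : ∀ {a} → a ≢ N + N → (p [ N + N ≔ row 0 ]) a ≡ p a
    other = update-other p (row 0)

  -- The list has fourteen entries, one for each of the registers 0 to 13 used by the program.
  correct : Terminates (running-time n) 0 (n ∷ replicate 13 0) p
  correct =
    run (word-≤N (s≤s z≤n) ,
    run (N , +-comm n 1 , word-≤N ≤-refl ,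
    run (_ , refl , word-N+ ≤-refl ,
    run (_ , refl , word-low ≤-refl ,
    run (run (word-≤N (s≤s z≤n) ,
    prepare n 0 refl prepared-initially))))))

theorem1 : Σ[ P ∈ Program ] Σ[ k ∈ ℕ ] Σ[ T ∈ (ℕ → ℕ) ] (T ∈O (_^ 2)) ×
    (∀ (n : ℕ) (π : Permutation′ n) →
    Σ[ d ∈ Configuration ] Σ[ M ∈ List (Fin n × Fin n) ] HaltsWithin P (wordBound k n) (T n) (initial π) d ×
    Outputs d M × IsMaximumInducedMatching (PermutationGraph π) M)
theorem1 = program , 3 , running-time , running-time-quadratic , λ n π →
  let open Correctness π
      d , halts , M , outputs , maximum =
        Verification.Terminates.from correct ((λ _ → 0) [ 0 ≔ n ]) (initial-registers n)
  in d , M , halts , outputs , maximum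
  where
  nth-zeros : ∀ k i → nth (replicate k 0) i ≡ 0
  nth-zeros zero    i       = refl
  nth-zeros (suc k) zero    = refl
  nth-zeros (suc k) (suc i) = nth-zeros k i
  initial-registers : ∀ n i → ((λ _ → 0) [ 0 ≔ n ]) i ≡ nth (n ∷ replicate 13 0) i
  initial-registers n zero    = refl
  initial-registers n (suc i) = sym (nth-zeros 13 i)
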